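{- For all integers $m,n\ge 0$ there is a bijection $f:\mathcal{D}(m,n)\to\mathcal{C}(m,n)$.
   Context: A Schur partition is a partition of an integer into positive parts such that consecutive parts differ by at least $3$, and no two consecutive parts differing by exactly $3$ are both multiples of $3$. For a partition $\pi$, $m(\pi)$ is the number of parts of $\pi$ plus the number of even parts of $\pi$. $\mathcal{D}(m,n)$ is the set of Schur partitions $\pi$ of $n$ with $m(\pi)=m$. $\mathcal{C}(m,n)$ is the set of partitions of $n$ into exactly $m$ odd parts, each part occurring at most twice. -}

module Defs where

open import Data.Bool using (Bool; true; false; _∧_; not; T)
open import Data.Nat using (ℕ; _+_; _%_; _≤ᵇ_; _≡ᵇ_)
open import Data.List using (List; []; _∷_; length; filterᵇ)
open import Data.Nat.ListAction using (sum)
open import Data.Bool.ListAction using (all)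
open import Data.Product using (Σ)

-- A partition is represented canonically as the list of its parts in
-- non-increasing order (largest part first).

isEven : ℕ → Bool
isEven k = k % 2 ≡ᵇ 0

isOdd : ℕ → Bool
isOdd k = not (isEven k)

divBy3 : ℕ → Bool
divBy3 k = k % 3 ≡ᵇ 0

positive : ℕ → Bool
positive k = 1 ≤ᵇ k

allPositive : List ℕ → Bool
allPositive = all positive

nonIncreasing : List ℕ → Bool
nonIncreasing []           = true
nonIncreasing (a ∷ [])     = true
nonIncreasing (a ∷ b ∷ xs) = (b ≤ᵇ a) ∧ nonIncreasing (b ∷ xs)

schurPair : ℕ → ℕ → Bool
schurPair a b = (b + 3 ≤ᵇ a) ∧ not ((a ≡ᵇ b + 3) ∧ (divBy3 a ∧ divBy3 b))

schurGaps : List ℕ → Bool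
schurGaps []           = true
schurGaps (a ∷ [])     = true
schurGaps (a ∷ b ∷ xs) = schurPair a b ∧ schurGaps (b ∷ xs)

isSchur : List ℕ → Bool
isSchur π = allPositive π ∧ schurGaps π

numEven : List ℕ → ℕ
numEven π = length (filterᵇ isEven π)

mStat : List ℕ → ℕ
mStat π = length π + numEven π

count : ℕ → List ℕ → ℕ
count k π = length (filterᵇ (λ x → x ≡ᵇ k) π)

atMostTwice : List ℕ → Bool
atMostTwice π = all (λ x → count x π ≤ᵇ 2) π

InD : ℕ → ℕ → List ℕ → Bool
InD m n π = isSchur π ∧ ((sum π ≡ᵇ n) ∧ (mStat π ≡ᵇ m))

InC : ℕ → ℕ → List ℕ → Bool
InC m n π = nonIncreasing π ∧ (all isOdd π ∧ ((length π ≡ᵇ m)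
              ∧ ((sum π ≡ᵇ n) ∧ atMostTwice π)))

-- The sets D(m,n) and C(m,n) as subtypes of List ℕ
-- (membership proofs T b are proof-irrelevant, so ≡ on these Σ-types is
-- equality of the underlying partitions).
D : ℕ → ℕ → Set
D m n = Σ (List ℕ) (λ π → T (InD m n π))

C : ℕ → ℕ → Set
C m n = Σ (List ℕ) (λ π → T (InC m n π))

{-# OPTIONS --safe #-}
module Submission where

-- Give a part n of a Schur partition the weight x q^n if n is odd and x² q^n if n is even, and let
-- S_j(x) be the generating polynomial of the Schur partitions with all parts at most 3j − 1.  Sorting
-- by the largest part gives a three-term recurrence for S_j, and with A(u) = 1 + u + u² an induction
-- on k proves
--   S_{2k+1}(x) = A(xq) S_{2k}(xq²),
--   S_{2k+2}(x) = A(xq) (S_{2k+1}(xq²) + x q^{6k+5} (1 − xq) S_{2k}(xq²)).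
-- Modulo q^N all S_j with j > 2N agree, so their common value F satisfies F(x) = A(xq) F(xq²), and
-- iterating gives F(x) = ∏_{j<N} A(xq^{2j+1}), the generating polynomial of the partitions into odd
-- parts less than 2N, each occurring at most twice.  The algebra takes place in a commutative
-- semiring with additive cancellation, and q^N = 0 replaces the passage to the limit.

open import Defs
open import Algebra.Bundles using (CommutativeSemiring)
open import Algebra.Definitions using (RightCancellative)
open import Algebra.Structures.Biased using (IsCommutativeSemiringˡ)
open import Data.Bool using (Bool; if_then_else_; true; false; T; _∧_; not)
open import Data.Bool.ListAction using (all)
open import Data.Bool.Properties using (T-∧; T-irrelevant)
open import Data.Empty using (⊥-elim)
open import Data.Fin.Base using (Fin)
open import Data.Fin.Properties using (1↔⊤; +↔⊎)
open import Data.List using (List; []; _∷_; length)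
open import Data.List.Relation.Unary.All as All using (All; []; _∷_)
open import Data.Nat as ℕ using (ℕ; zero; suc; _≤_; _<_; z≤n; s≤s)
open import Data.Nat.DivMod using ([m+n]%n≡m%n; [m+kn]%n≡m%n)
open import Data.Nat.ListAction using (sum)
import Data.Nat.Properties as ℕ
open import Data.Nat.Tactic.RingSolver using (solve-∀)
open import Data.Product using (Σ; _×_; _,_; proj₁; proj₂)
open import Data.Sum using (_⊎_; inj₁; inj₂; [_,_])
open import Data.Sum.Function.Propositional using (_⊎-↔_)
open import Data.Unit using (tt)
open import Function using (_∘_)
open import Function.Bundles using (_⤖_; _↔_; mk↔ₛ′; module Inverse; module Equivalence)
open import Function.Construct.Composition using (_↔-∘_)
open import Function.Construct.Symmetry using (↔-sym)
open import Function.Properties.Inverse using (↔⇒⤖)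
open import Level using (Level; 0ℓ)
open import Relation.Binary.PropositionalEquality as ≡ using (_≡_; _≢_)
open import Relation.Binary.Structures using (IsEquivalence)
open import Relation.Nullary using (¬_; yes; no; contradiction)

-- Weights and gaps of parts modulo 6.

wt : ℕ → ℕ
wt n = if isEven n then 2 else 1

-- In a Schur partition, the part following n is at most (n − 1) ∸ lag n.
lag : ℕ → ℕ
lag n = if divBy3 n then 3 else 2

lag-periodic : ∀ r j → lag (r ℕ.+ j ℕ.* 3) ≡ lag r
lag-periodic r j = ≡.cong (λ k → if k ℕ.≡ᵇ 0 then 3 else 2) ([m+kn]%n≡m%n r j 3)

-- The period 6k is bracketed as `k * 2 * 3` because it arises as three times the index 2k of `S`;
-- parity needs it as a multiple of 2.
wt-periodic : ∀ r k → wt (r ℕ.+ k ℕ.* 2 ℕ.* 3) ≡ wt r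
wt-periodic r k = ≡.cong (λ k → if k ℕ.≡ᵇ 0 then 2 else 1)
  (≡.trans (≡.cong (λ z → (r ℕ.+ z) ℕ.% 2) k*2*3≡k*3*2) ([m+kn]%n≡m%n r (k ℕ.* 3) 2))
  where
  k*2*3≡k*3*2 : k ℕ.* 2 ℕ.* 3 ≡ k ℕ.* 3 ℕ.* 2
  k*2*3≡k*3*2 = ≡.trans (ℕ.*-assoc k 2 3) (≡.sym (ℕ.*-assoc k 3 2))

-- Semiring identities behind the induction on k.

module FunctionalEquation {κ ℓ : Level} (R : CommutativeSemiring κ ℓ)
  (+-cancelʳ : RightCancellative (CommutativeSemiring._≈_ R) (CommutativeSemiring._+_ R))
  (q : CommutativeSemiring.Carrier R) where

  open CommutativeSemiring R

  open import Algebra.Properties.Semiring.Exp semiring using (_^_; ^-homo-*; ^-congˡ)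
  open import Algebra.Solver.Ring.NaturalCoefficients.Default R
    using (solve; _:+_; _:*_; _:^_; _:=_; con)
  open import Relation.Binary.Reasoning.Setoid setoid

  A : Carrier → Carrier
  A u = 1# + u + u * u

  -- In the application u = xq, t = x q^{6k+5} and c = q²t; moreover eᵢ and oᵢ are S_{2k+2i} and
  -- S_{2k+1+2i} at xq², while Eᵢ and Oᵢ are the same at x.  All identities have their negative
  -- terms moved to the other side.
  module _ (u c t e₀ o₀ e₁ : Carrier)
    (h₁ : e₁ + u * u * c * t * e₀ ≈ (1# + c + u * c) * o₀ + t * e₀)
    (E₁ : Carrier)
    (hJ : E₁ + u * t * (A u * e₀) ≈ A u * (o₀ + t * e₀)) where

    -- The recurrences `h₁` and `h₂` share the coefficient 1 + c + uc. Multiplying `hJ` by it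
    -- eliminates `E₁` from `h₂`, and `h₁` then trades `o₀` for `e₁`. The summand to be cancelled
    -- holds the negative terms of `h₂` and of the multiplied `hJ`.
    odd-step : ∀ O₀ O₁ → O₀ ≈ A u * e₀ →
      O₁ + c * t * O₀ ≈ (1# + c + u * c) * E₁ + u * t * O₀ →
      O₁ ≈ A u * e₁
    odd-step O₀ O₁ hI h₂ = +-cancelʳ (c * t * O₀ + (1# + c + u * c) * (u * t * (A u * e₀))) _ _ (begin
      O₁ + (c * t * O₀ + (1# + c + u * c) * (u * t * (A u * e₀)))
        ≈⟨ +-assoc _ _ _ ⟨
      O₁ + c * t * O₀ + (1# + c + u * c) * (u * t * (A u * e₀))
        ≈⟨ +-congʳ h₂ ⟩
      (1# + c + u * c) * E₁ + u * t * O₀ + (1# + c + u * c) * (u * t * (A u * e₀))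
        ≈⟨ solve 5 (λ u c t E y →
             (con 1 :+ c :+ u :* c) :* E :+ y :+ (con 1 :+ c :+ u :* c) :* t :=
             (con 1 :+ c :+ u :* c) :* (E :+ t) :+ y) refl u c _ E₁ _ ⟩
      (1# + c + u * c) * (E₁ + u * t * (A u * e₀)) + u * t * O₀
        ≈⟨ +-cong (*-congˡ hJ) (*-congˡ hI) ⟩
      (1# + c + u * c) * (A u * (o₀ + t * e₀)) + u * t * (A u * e₀)
        ≈⟨ solve 6 (λ u c t A e o →
             (con 1 :+ c :+ u :* c) :* (A :* (o :+ t :* e)) :+ u :* t :* (A :* e) :=
             A :* ((con 1 :+ c :+ u :* c) :* o :+ t :* e)
               :+ (u :* c :* t :+ c :* t :+ u :* t) :* (A :* e)) refl u c t (A u) e₀ o₀ ⟩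
      A u * ((1# + c + u * c) * o₀ + t * e₀) + (u * c * t + c * t + u * t) * (A u * e₀)
        ≈⟨ +-congʳ (*-congˡ h₁) ⟨
      A u * (e₁ + u * u * c * t * e₀) + (u * c * t + c * t + u * t) * (A u * e₀)
        ≈⟨ solve 6 (λ u c t A e e₁ →
             A :* (e₁ :+ u :* u :* c :* t :* e) :+ (u :* c :* t :+ c :* t :+ u :* t) :* (A :* e) :=
             A :* e₁ :+ (c :* t :* (A :* e) :+ (con 1 :+ c :+ u :* c) :* (u :* t :* (A :* e))))
             refl u c t (A u) e₀ e₁ ⟩
      A u * e₁ + (c * t * (A u * e₀) + (1# + c + u * c) * (u * t * (A u * e₀)))
        ≈⟨ +-congˡ (+-congʳ (*-congˡ hI)) ⟨
      A u * e₁ + (c * t * O₀ + (1# + c + u * c) * (u * t * (A u * e₀))) ∎)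

    -- With subtraction this reads (1 - u²c) E₁ = A(u) ((1 - u) e₁ + (u - c) o₀). It is (1 - u²c)
    -- times `hJ` minus (1 - u) A(u) times `h₁`: in both products `e₀` has coefficient t (1 - u)(1 -
    -- u²c) A(u), so it drops out.
    E₁-e₁-o₀ : E₁ + u * (A u * e₁) + c * (A u * o₀) ≈ u * u * c * E₁ + A u * e₁ + u * (A u * o₀)
    E₁-e₁-o₀ = +-cancelʳ z _ _ (begin
      E₁ + u * (A u * e₁) + c * (A u * o₀) + z
        ≈⟨ solve 9 (λ u c t A e o e₁ E₁ w →
             E₁ :+ u :* (A :* e₁) :+ c :* (A :* o)
               :+ (w :+ u :* u :* c :* w :+ (u :+ con 1) :* (A :* (u :* u :* c :* t :* e))) :=
             (E₁ :+ w) :+ u :* (A :* (e₁ :+ u :* u :* c :* t :* e)) :+ c :* (A :* o)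
               :+ (u :* u :* c :* w :+ A :* (u :* u :* c :* t :* e)))
             refl u c t (A u) e₀ o₀ e₁ E₁ (u * t * (A u * e₀)) ⟩
      (E₁ + u * t * (A u * e₀)) + u * (A u * (e₁ + u * u * c * t * e₀)) + c * (A u * o₀)
        + (u * u * c * (u * t * (A u * e₀)) + A u * (u * u * c * t * e₀))
        ≈⟨ +-congʳ (+-congʳ (+-cong hJ (*-congˡ (*-congˡ h₁)))) ⟩
      A u * (o₀ + t * e₀) + u * (A u * ((1# + c + u * c) * o₀ + t * e₀)) + c * (A u * o₀)
        + (u * u * c * (u * t * (A u * e₀)) + A u * (u * u * c * t * e₀))
        ≈⟨ solve 6 (λ u c t A e o →
             A :* (o :+ t :* e) :+ u :* (A :* ((con 1 :+ c :+ u :* c) :* o :+ t :* e)) :+ c :* (A :* o)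
               :+ (u :* u :* c :* (u :* t :* (A :* e)) :+ A :* (u :* u :* c :* t :* e)) :=
             u :* u :* c :* (A :* (o :+ t :* e)) :+ A :* ((con 1 :+ c :+ u :* c) :* o :+ t :* e)
               :+ u :* (A :* o) :+ (u :* t :* (A :* e) :+ u :* (A :* (u :* u :* c :* t :* e))))
             refl u c t (A u) e₀ o₀ ⟩
      u * u * c * (A u * (o₀ + t * e₀)) + A u * ((1# + c + u * c) * o₀ + t * e₀)
        + u * (A u * o₀) + (u * t * (A u * e₀) + u * (A u * (u * u * c * t * e₀)))
        ≈⟨ +-congʳ (+-congʳ (+-cong (*-congˡ hJ) (*-congˡ h₁))) ⟨
      u * u * c * (E₁ + u * t * (A u * e₀)) + A u * (e₁ + u * u * c * t * e₀)
        + u * (A u * o₀) + (u * t * (A u * e₀) + u * (A u * (u * u * c * t * e₀)))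
        ≈⟨ solve 9 (λ u c t A e o e₁ E₁ w →
             u :* u :* c :* (E₁ :+ w) :+ A :* (e₁ :+ u :* u :* c :* t :* e)
               :+ u :* (A :* o) :+ (w :+ u :* (A :* (u :* u :* c :* t :* e))) :=
             u :* u :* c :* E₁ :+ A :* e₁ :+ u :* (A :* o)
               :+ (w :+ u :* u :* c :* w :+ (u :+ con 1) :* (A :* (u :* u :* c :* t :* e))))
             refl u c t (A u) e₀ o₀ e₁ E₁ (u * t * (A u * e₀)) ⟩
      u * u * c * E₁ + A u * e₁ + u * (A u * o₀) + z ∎)
      where
      z : Carrier
      z = u * t * (A u * e₀) + u * u * c * (u * t * (A u * e₀))
          + (u + 1#) * (A u * (u * u * c * t * e₀))

    -- Once `O₁` is replaced by A(u) e₁, the terms regroup so that d multiplies exactly the left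
    -- side of `E₁-e₁-o₀`; its right side supplies what `h₂` needs to produce `o₁`.
    even-step : ∀ d t′ o₁ O₁ E₂ → O₁ ≈ A u * e₁ →
      o₁ + d * c * o₀ ≈ (1# + d + u * t′) * e₁ + u * d * o₀ →
      E₂ + u * u * d * c * E₁ ≈ (1# + t′ + u * d) * O₁ + d * E₁ →
      E₂ + u * t′ * (A u * e₁) ≈ A u * (o₁ + t′ * e₁)
    even-step d t′ o₁ O₁ E₂ hI h₂ h₃ = +-cancelʳ (u * u * d * c * E₁ + d * c * (A u * o₀)) _ _ (begin
      E₂ + u * t′ * (A u * e₁) + (u * u * d * c * E₁ + d * c * (A u * o₀))
        ≈⟨ solve 4 (λ a b c d → a :+ b :+ (c :+ d) := (a :+ c) :+ (b :+ d)) refl _ _ _ _ ⟩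
      (E₂ + u * u * d * c * E₁) + (u * t′ * (A u * e₁) + d * c * (A u * o₀))
        ≈⟨ +-congʳ (trans h₃ (+-congʳ (*-congˡ hI))) ⟩
      ((1# + t′ + u * d) * (A u * e₁) + d * E₁) + (u * t′ * (A u * e₁) + d * c * (A u * o₀))
        ≈⟨ solve 7 (λ u c d t e o E →
             ((con 1 :+ t :+ u :* d) :* e :+ d :* E) :+ (u :* t :* e :+ d :* c :* o) :=
             (con 1 :+ t :+ u :* t) :* e :+ d :* (E :+ u :* e :+ c :* o))
             refl u c d t′ (A u * e₁) (A u * o₀) E₁ ⟩
      (1# + t′ + u * t′) * (A u * e₁) + d * (E₁ + u * (A u * e₁) + c * (A u * o₀))
        ≈⟨ +-congˡ (*-congˡ E₁-e₁-o₀) ⟩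
      (1# + t′ + u * t′) * (A u * e₁) + d * (u * u * c * E₁ + A u * e₁ + u * (A u * o₀))
        ≈⟨ solve 8 (λ u c d t e o E A →
             (con 1 :+ t :+ u :* t) :* (A :* e) :+ d :* (u :* u :* c :* E :+ A :* e :+ u :* (A :* o)) :=
             A :* ((con 1 :+ d :+ u :* t) :* e :+ u :* d :* o) :+ (t :* (A :* e) :+ u :* u :* d :* c :* E))
             refl u c d t′ e₁ o₀ E₁ (A u) ⟩
      A u * ((1# + d + u * t′) * e₁ + u * d * o₀) + (t′ * (A u * e₁) + u * u * d * c * E₁)
        ≈⟨ +-congʳ (*-congˡ h₂) ⟨
      A u * (o₁ + d * c * o₀) + (t′ * (A u * e₁) + u * u * d * c * E₁)
        ≈⟨ solve 8 (λ c d t e o o₁ w A →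
             A :* (o₁ :+ d :* c :* o) :+ (t :* (A :* e) :+ w) :=
             A :* (o₁ :+ t :* e) :+ (w :+ d :* c :* (A :* o)))
             refl c d t′ e₁ o₀ o₁ (u * u * d * c * E₁) (A u) ⟩
      A u * (o₁ + t′ * e₁) + (u * u * d * c * E₁ + d * c * (A u * o₀)) ∎)

  -- Schur partitions with bounded parts and their three-term recurrence.

  weight : Carrier → ℕ → Carrier
  weight x n = x ^ wt n * q ^ n

  -- schurGF x n l counts the Schur partitions with all parts at most n ∸ l.
  schurGF : Carrier → ℕ → ℕ → Carrier
  schurGF x zero    l       = 1#
  schurGF x (suc n) (suc l) = schurGF x n l
  schurGF x (suc n) zero    = schurGF x n 0 + weight x (suc n) * schurGF x n (lag (suc n))

  -- S x j counts the Schur partitions with all parts at most 3j − 1.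
  S : Carrier → ℕ → Carrier
  S x j = schurGF x (j ℕ.* 3) 1

  schurGF-step : ∀ x r j {v} → weight x (suc r ℕ.+ j ℕ.* 3) ≈ v →
    schurGF x (suc r ℕ.+ j ℕ.* 3) 0 ≈
    schurGF x (r ℕ.+ j ℕ.* 3) 0 + v * schurGF x (r ℕ.+ j ℕ.* 3) (lag (suc r))
  schurGF-step x r j weight≈v rewrite lag-periodic (suc r) j = +-congˡ (*-congʳ weight≈v)

  -- Below a largest part 3j + 2 or 3j + 3 the parts are at most 3j - 1, and below 3j + 5 at most 3j
  -- + 2. Below 3j + 4 they are at most 3j + 1, which is counted by S_{j+1} - a S_j; this difference
  -- is the origin of `c * a * S x j`.
  S-rec : ∀ x j {a b c d} →
    weight x (2 ℕ.+ j ℕ.* 3) ≈ a → weight x (3 ℕ.+ j ℕ.* 3) ≈ b →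
    weight x (4 ℕ.+ j ℕ.* 3) ≈ c → weight x (5 ℕ.+ j ℕ.* 3) ≈ d →
    S x (2 ℕ.+ j) + c * a * S x j ≈ (1# + c + d) * S x (1 ℕ.+ j) + b * S x j
  S-rec x j {a} {b} {c} {d} a≈ b≈ c≈ d≈ = begin
    S x (2 ℕ.+ j) + c * a * e
      ≈⟨ +-congʳ (schurGF-step x 4 j d≈) ⟩
    schurGF x (4 ℕ.+ j ℕ.* 3) 0 + d * S x (1 ℕ.+ j) + c * a * e
      ≈⟨ +-congʳ (+-congʳ (trans (schurGF-step x 3 j c≈) (+-congʳ (schurGF-step x 2 j b≈)))) ⟩
    S x (1 ℕ.+ j) + b * e + c * s₁ + d * S x (1 ℕ.+ j) + c * a * e
      ≈⟨ +-congʳ (+-cong (+-congʳ (+-congʳ S₁≈)) (*-congˡ S₁≈)) ⟩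
    s₁ + a * e + b * e + c * s₁ + d * (s₁ + a * e) + c * a * e
      ≈⟨ solve 6 (λ a b c d e y →
           y :+ a :* e :+ b :* e :+ c :* y :+ d :* (y :+ a :* e) :+ c :* a :* e :=
           (con 1 :+ c :+ d) :* (y :+ a :* e) :+ b :* e) refl a b c d e s₁ ⟩
    (1# + c + d) * (s₁ + a * e) + b * e
      ≈⟨ +-congʳ (*-congˡ S₁≈) ⟨
    (1# + c + d) * S x (1 ℕ.+ j) + b * e ∎
    where
    s₁ e : Carrier
    s₁ = schurGF x (1 ℕ.+ j ℕ.* 3) 0
    e = S x j
    S₁≈ : S x (1 ℕ.+ j) ≈ s₁ + a * e
    S₁≈ = schurGF-step x 1 j a≈

  -- The two identities by induction on k.

  module _ (x : Carrier) (k : ℕ) where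

    private
      K = k ℕ.* 2 ℕ.* 3
      x̃ = x * q * q
      u = x * q
      t = x * q ^ (5 ℕ.+ K)
      c′ = x * q ^ (7 ℕ.+ K)
      d = x * q ^ (9 ℕ.+ K)
      t′ = x * q ^ (11 ℕ.+ K)

    weight-odd : ∀ y r {v} → wt r ≡ 1 → y * q ^ (r ℕ.+ K) ≈ v → weight y (r ℕ.+ K) ≈ v
    weight-odd y r odd eq rewrite wt-periodic r k | odd = trans (*-congʳ (*-identityʳ y)) eq

    weight-even : ∀ y r {v} → wt r ≡ 2 → y * y * q ^ (r ℕ.+ K) ≈ v → weight y (r ℕ.+ K) ≈ v
    weight-even y r even eq rewrite wt-periodic r k | even =
      trans (*-congʳ (*-congˡ (*-identityʳ y))) eq

    odd≈ : ∀ r → wt r ≡ 1 → weight x (r ℕ.+ K) ≈ x * q ^ (r ℕ.+ K)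
    odd≈ r odd = weight-odd x r odd refl

    -- Splitting off u = xq turns an even weight into u times a monomial of the shape of an odd
    -- weight. The recurrences at x and at xq² then have coefficients in the same few monomials t,
    -- c′, d, t′, as the elimination identities require.
    even≈ : ∀ r → wt (suc r) ≡ 2 → weight x (suc r ℕ.+ K) ≈ u * (x * q ^ (r ℕ.+ K))
    even≈ r even = weight-even x (suc r) even
      (solve 3 (λ x q y → x :* x :* (q :* y) := x :* q :* (x :* y)) refl x q _)

    shifted-odd≈ : ∀ r → wt r ≡ 1 → weight x̃ (r ℕ.+ K) ≈ x * q ^ (2 ℕ.+ r ℕ.+ K)
    shifted-odd≈ r odd = weight-odd x̃ r odd
      (solve 3 (λ x q y → x :* q :* q :* y := x :* (q :* (q :* y))) refl x q _)

    shifted-even≈ : ∀ r → wt r ≡ 2 → weight x̃ (r ℕ.+ K) ≈ u * (x * q ^ (3 ℕ.+ r ℕ.+ K))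
    shifted-even≈ r even = weight-even x̃ r even
      (solve 3 (λ x q y → x :* q :* q :* (x :* q :* q) :* y :=
                          x :* q :* (x :* (q :* (q :* (q :* y))))) refl x q _)

    OddIdentity EvenIdentity : Set ℓ
    OddIdentity = S x (1 ℕ.+ k ℕ.* 2) ≈ A u * S x̃ (k ℕ.* 2)
    EvenIdentity = S x (2 ℕ.+ k ℕ.* 2) + u * t * (A u * S x̃ (k ℕ.* 2))
             ≈ A u * (S x̃ (1 ℕ.+ k ℕ.* 2) + t * S x̃ (k ℕ.* 2))

    private
      h₁ : S x̃ (2 ℕ.+ k ℕ.* 2) + u * u * c′ * t * S x̃ (k ℕ.* 2)
           ≈ (1# + c′ + u * c′) * S x̃ (1 ℕ.+ k ℕ.* 2) + t * S x̃ (k ℕ.* 2)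
      h₁ = trans (+-congˡ (*-congʳ (solve 3 (λ u c t →
             u :* u :* c :* t := u :* c :* (u :* t)) refl u c′ t)))
             (trans (S-rec x̃ (k ℕ.* 2) (shifted-even≈ 2 ≡.refl) (shifted-odd≈ 3 ≡.refl)
                                       (shifted-even≈ 4 ≡.refl) (shifted-odd≈ 5 ≡.refl))
               (+-congʳ (*-congʳ (solve 2 (λ u c →
                 con 1 :+ u :* c :+ c := con 1 :+ c :+ u :* c) refl u c′))))

    odd-suc : OddIdentity → EvenIdentity → S x (3 ℕ.+ k ℕ.* 2) ≈ A u * S x̃ (2 ℕ.+ k ℕ.* 2)
    odd-suc hI hJ = odd-step u c′ t _ _ _ h₁ _ hJ _ _ hI
      (S-rec x (1 ℕ.+ k ℕ.* 2) (odd≈ 5 ≡.refl) (even≈ 5 ≡.refl) (odd≈ 7 ≡.refl) (even≈ 7 ≡.refl))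

    even-suc : OddIdentity → EvenIdentity →
      S x (4 ℕ.+ k ℕ.* 2) + u * t′ * (A u * S x̃ (2 ℕ.+ k ℕ.* 2))
      ≈ A u * (S x̃ (3 ℕ.+ k ℕ.* 2) + t′ * S x̃ (2 ℕ.+ k ℕ.* 2))
    even-suc hI hJ = even-step u c′ t _ _ _ h₁ _ hJ d t′ _ _ _ (odd-suc hI hJ)
      (S-rec x̃ (1 ℕ.+ k ℕ.* 2) (shifted-odd≈ 5 ≡.refl) (shifted-even≈ 6 ≡.refl)
                                (shifted-odd≈ 7 ≡.refl) (shifted-even≈ 8 ≡.refl))
      (trans (+-congˡ (*-congʳ (solve 3 (λ u c d →
             u :* u :* d :* c := u :* d :* (u :* c)) refl u c′ d)))
        (trans (S-rec x (2 ℕ.+ k ℕ.* 2) (even≈ 7 ≡.refl) (odd≈ 9 ≡.refl)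
                                        (even≈ 9 ≡.refl) (odd≈ 11 ≡.refl))
          (+-congʳ (*-congʳ (solve 3 (λ u d t →
                 con 1 :+ u :* d :+ t := con 1 :+ t :+ u :* d) refl u d t′)))))

  S₁≈A : ∀ x → S x 1 ≈ A (x * q)
  S₁≈A x = solve 2 (λ x q →
    con 1 :+ x :* con 1 :* (q :* con 1) :* con 1
          :+ x :* (x :* con 1) :* (q :* (q :* con 1)) :* con 1 :=
    con 1 :+ x :* q :+ x :* q :* (x :* q)) refl x q

  oddIdentity₀ : ∀ x → OddIdentity x 0
  oddIdentity₀ x = trans (S₁≈A x) (sym (*-identityʳ _))

  -- Here S_0 = 1, S_1(x) = A(xq) and S_1(xq²) = A(xq³) are explicit, so one use of the recurrence
  -- leaves a polynomial identity in x and q.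
  evenIdentity₀ : ∀ x → EvenIdentity x 0
  evenIdentity₀ x = +-cancelʳ (c * a * 1#) _ _ (begin
    S x 2 + x * q * t * (A (x * q) * 1#) + c * a * 1#
      ≈⟨ solve 3 (λ a b c → a :+ b :+ c := a :+ c :+ b) refl _ _ _ ⟩
    S x 2 + c * a * 1# + x * q * t * (A (x * q) * 1#)
      ≈⟨ +-congʳ (S-rec x 0 (even≈ x 0 1 ≡.refl) (odd≈ x 0 3 ≡.refl)
                            (even≈ x 0 3 ≡.refl) (odd≈ x 0 5 ≡.refl)) ⟩
    (1# + c + t) * S x 1 + x * q ^ 3 * 1# + x * q * t * (A (x * q) * 1#)
      ≈⟨ +-congʳ (+-congʳ (*-congˡ (S₁≈A x))) ⟩
    (1# + c + t) * A (x * q) + x * q ^ 3 * 1# + x * q * t * (A (x * q) * 1#)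
      ≈⟨ solve 2 (λ x q →
           let u = x :* q
               r = x :* q :^ 3
               t = x :* q :^ 5
               A = λ u → con 1 :+ u :+ u :* u
           in (con 1 :+ u :* r :+ t) :* A u :+ r :* con 1 :+ u :* t :* (A u :* con 1) :=
              A u :* (A (x :* q :* q :* q) :+ t :* con 1)
                :+ u :* r :* (u :* (x :* q :^ 1)) :* con 1) refl x q ⟩
    A (x * q) * (A (x * q * q * q) + t * 1#) + c * a * 1#
      ≈⟨ +-congʳ (*-congˡ (+-congʳ (S₁≈A (x * q * q)))) ⟨
    A (x * q) * (S (x * q * q) 1 + t * 1#) + c * a * 1# ∎)
    where
    a c t : Carrier
    a = x * q * (x * q ^ 1)
    c = x * q * (x * q ^ 3)
    t = x * q ^ 5

  identities : ∀ x k → OddIdentity x k × EvenIdentity x k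
  identities x zero    = oddIdentity₀ x , evenIdentity₀ x
  identities x (suc k) = let hI , hJ = identities x k in odd-suc x k hI hJ , even-suc x k hI hJ

  schurGF-cong : ∀ {x y} → x ≈ y → ∀ n l → schurGF x n l ≈ schurGF y n l
  schurGF-cong x≈y zero    l       = refl
  schurGF-cong x≈y (suc n) (suc l) = schurGF-cong x≈y n l
  schurGF-cong x≈y (suc n) zero    = +-cong (schurGF-cong x≈y n 0)
    (*-cong (*-congʳ (^-congˡ (wt (suc n)) x≈y)) (schurGF-cong x≈y n _))

  weight-zero : ∀ {x} n → x ≈ 0# → weight x n ≈ 0#
  weight-zero n x≈0 with isEven n
  ... | true  = trans (*-congʳ (trans (*-congʳ x≈0) (zeroˡ _))) (zeroˡ _)
  ... | false = trans (*-congʳ (trans (*-congʳ x≈0) (zeroˡ _))) (zeroˡ _)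

  schurGF-zero : ∀ {x} → x ≈ 0# → ∀ n l → schurGF x n l ≈ 1#
  schurGF-zero x≈0 zero    l       = refl
  schurGF-zero x≈0 (suc n) (suc l) = schurGF-zero x≈0 n l
  schurGF-zero x≈0 (suc n) zero    = trans
    (+-cong (schurGF-zero x≈0 n 0) (trans (*-congʳ (weight-zero (suc n) x≈0)) (zeroˡ _)))
    (+-identityʳ 1#)

  -- The factor is A(xq^{2m+1}), expanded into monomials x^a q^b so that `counts-monomial` applies
  -- to each summand as it stands.
  oddGF : Carrier → ℕ → Carrier
  oddGF x zero    = 1#
  oddGF x (suc m) = (1# + x ^ 1 * q ^ suc (m ℕ.* 2)
                        + x ^ 2 * q ^ (suc (m ℕ.* 2) ℕ.+ suc (m ℕ.* 2))) * oddGF x m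

  -- Iterating the functional equation when q^N = 0.

  module Nilpotent (N : ℕ) (q^N≈0 : q ^ N ≈ 0#) where

    q^≈0 : ∀ {n} → N ℕ.≤ n → q ^ n ≈ 0#
    q^≈0 {n} N≤n = begin
      q ^ n                    ≡⟨ ≡.cong (q ^_) (ℕ.m∸n+n≡m N≤n) ⟨
      q ^ (n ℕ.∸ N ℕ.+ N)      ≈⟨ ^-homo-* q (n ℕ.∸ N) N ⟩
      q ^ (n ℕ.∸ N) * q ^ N    ≈⟨ *-congˡ q^N≈0 ⟩
      q ^ (n ℕ.∸ N) * 0#       ≈⟨ zeroʳ _ ⟩
      0#                       ∎

    N≤r+6N : ∀ r → N ℕ.≤ r ℕ.+ N ℕ.* 2 ℕ.* 3
    N≤r+6N r = ℕ.≤-trans (ℕ.≤-trans (ℕ.m≤m*n N 2) (ℕ.m≤m*n (N ℕ.* 2) 3)) (ℕ.m≤n+m _ r)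

    xq^≈0 : ∀ y r → y * q ^ (r ℕ.+ N ℕ.* 2 ℕ.* 3) ≈ 0#
    xq^≈0 y r = trans (*-congˡ (q^≈0 (N≤r+6N r))) (zeroʳ y)

    F : Carrier → Carrier
    F x = S x (1 ℕ.+ N ℕ.* 2)

    F-cong : ∀ {x y} → x ≈ y → F x ≈ F y
    F-cong x≈y = schurGF-cong x≈y (3 ℕ.+ N ℕ.* 2 ℕ.* 3) 1

    -- The weights of the parts 6N + 2 to 6N + 5 all contain q^N, so every coefficient of the
    -- recurrence except the 1 vanishes.
    F-stable : ∀ x → S x (2 ℕ.+ N ℕ.* 2) ≈ F x
    F-stable x = begin
      S x (2 ℕ.+ N ℕ.* 2)
        ≈⟨ solve 2 (λ a b → a := a :+ con 0 :* con 0 :* b) refl _ _ ⟩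
      S x (2 ℕ.+ N ℕ.* 2) + 0# * 0# * S x (N ℕ.* 2)
        ≈⟨ S-rec x (N ℕ.* 2) (xq^≈0 _ 2) (xq^≈0 _ 3) (xq^≈0 _ 4) (xq^≈0 _ 5) ⟩
      (1# + 0# + 0#) * F x + 0# * S x (N ℕ.* 2)
        ≈⟨ solve 2 (λ a b → (con 1 :+ con 0 :+ con 0) :* a :+ con 0 :* b := a) refl _ _ ⟩
      F x ∎

    -- This is the even identity at k = N, where t contains q^{6N+5} = 0. The index 2N + 1 in `F` is
    -- the one occurring at xq² in that identity; the index 2N + 2 at x is absorbed by `F-stable`.
    F-functional : ∀ x → F x ≈ A (x * q) * F (x * q * q)
    F-functional x = begin
      F x                                         ≈⟨ F-stable x ⟨
      S x (2 ℕ.+ N ℕ.* 2)                         ≈⟨ +-identityʳ _ ⟨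
      S x (2 ℕ.+ N ℕ.* 2) + 0#                    ≈⟨ +-congˡ vanish ⟨
      S x (2 ℕ.+ N ℕ.* 2) + x * q * t * B         ≈⟨ proj₂ (identities x N) ⟩
      A (x * q) * (F (x * q * q) + t * S (x * q * q) (N ℕ.* 2))
        ≈⟨ *-congˡ (trans (+-congˡ (trans (*-congʳ (xq^≈0 x 5)) (zeroˡ _))) (+-identityʳ _)) ⟩
      A (x * q) * F (x * q * q)                   ∎
      where
      t B : Carrier
      t = x * q ^ (5 ℕ.+ N ℕ.* 2 ℕ.* 3)
      B = A (x * q) * S (x * q * q) (N ℕ.* 2)
      vanish : x * q * t * B ≈ 0#
      vanish = trans (*-congʳ (trans (*-congˡ (xq^≈0 x 5)) (zeroʳ _))) (zeroˡ _)

    F-unroll : ∀ x m → F x ≈ oddGF x m * F (x * q ^ (m ℕ.* 2))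
    F-unroll x zero    = trans (F-cong (sym (*-identityʳ x))) (sym (*-identityˡ _))
    F-unroll x (suc m) = begin
      F x                                            ≈⟨ F-unroll x m ⟩
      oddGF x m * F y                                ≈⟨ *-congˡ (F-functional y) ⟩
      oddGF x m * (A (y * q) * F (y * q * q))
        ≈⟨ *-congˡ (*-congˡ (F-cong
             (solve 3 (λ x q y → x :* y :* q :* q := x :* (q :* (q :* y))) refl x q _))) ⟩
      oddGF x m * (A (y * q) * F (x * q ^ (suc m ℕ.* 2)))
        ≈⟨ solve 5 (λ x q y o f →
             o :* ((con 1 :+ x :* y :* q :+ x :* y :* q :* (x :* y :* q)) :* f) :=
             (con 1 :+ x :^ 1 :* (q :* y) :+ x :^ 2 :* ((q :* y) :* (q :* y))) :* o :* f)
             refl x q (q ^ (m ℕ.* 2)) (oddGF x m) _ ⟩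
      (1# + x ^ 1 * z + x ^ 2 * (z * z)) * oddGF x m * F (x * q ^ (suc m ℕ.* 2))
        ≈⟨ *-congʳ (*-congʳ (+-congˡ (*-congˡ (^-homo-* q (suc (m ℕ.* 2)) _)))) ⟨
      oddGF x (suc m) * F (x * q ^ (suc m ℕ.* 2))     ∎
      where
      y z : Carrier
      y = x * q ^ (m ℕ.* 2)
      z = q ^ suc (m ℕ.* 2)

    F≈oddGF : ∀ x → F x ≈ oddGF x N
    F≈oddGF x = begin
      F x                               ≈⟨ F-unroll x N ⟩
      oddGF x N * F (x * q ^ (N ℕ.* 2))
        -- After N steps the argument contains q^{2N} = 0, and at argument 0 only the empty
        -- partition contributes.
        ≈⟨ *-congˡ (schurGF-zero (trans (*-congˡ (q^≈0 (ℕ.m≤m*n N 2))) (zeroʳ x))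
                                 (3 ℕ.+ N ℕ.* 2 ℕ.* 3) 1) ⟩
      oddGF x N * 1#                    ≈⟨ *-identityʳ _ ⟩
      oddGF x N                         ∎

-- Polynomials modulo q^N acting on coefficient arrays.

open ≡ using (refl; cong; cong₂; sym; trans; subst)

infixl 6 _⊕_
infixl 7 _⊗_

-- Polynomials in x and q with natural coefficients, given by expressions and compared through their
-- action on coefficient arrays, so that the semiring laws hold without any convolution.
data Poly : Set where
  𝟘 𝟙 X Q : Poly
  _⊕_ _⊗_ : Poly → Poly → Poly

Grid : Set
Grid = ℕ → ℕ → ℕ

act : Poly → Grid → Grid
act 𝟘       f m       n       = 0
act 𝟙       f m       n       = f m n
act X       f zero    n       = 0
act X       f (suc m) n       = f m n
act Q       f m       zero    = 0
act Q       f m       (suc n) = f m n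
act (p ⊕ r) f m       n       = act p f m n ℕ.+ act r f m n
act (p ⊗ r) f m       n       = act p (act r f) m n

-- The coefficient array of the polynomial 1, so that `act p δ` lists the coefficients of `p`.
δ : Grid
δ zero    zero    = 1
δ zero    (suc n) = 0
δ (suc m) n       = 0

module Truncated (N : ℕ) where

  infix 4 _≐_ _≈_

  -- The first index is the exponent of x, the second that of q; the bound on n makes this equality
  -- modulo q^N.
  _≐_ : Grid → Grid → Set
  f ≐ g = ∀ m n → n ℕ.< N → f m n ≡ g m n

  -- Comparing the actions on all arrays, and not only on `δ`, makes `⊗` a congruence in its left
  -- factor at once.
  _≈_ : Poly → Poly → Set
  p ≈ r = ∀ f → act p f ≐ act r f

  -- An action never reads an entry with a larger exponent of q than the one it computes, so the
  -- window n < N is preserved.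
  act-cong : ∀ p {f g} → f ≐ g → act p f ≐ act p g
  act-cong 𝟘       f≐g m       n       n<N = refl
  act-cong 𝟙       f≐g m       n       n<N = f≐g m n n<N
  act-cong X       f≐g zero    n       n<N = refl
  act-cong X       f≐g (suc m) n       n<N = f≐g m n n<N
  act-cong Q       f≐g m       zero    n<N = refl
  act-cong Q       f≐g m       (suc n) n<N = f≐g m n (ℕ.<-trans (ℕ.n<1+n n) n<N)
  act-cong (p ⊕ r) f≐g m       n       n<N =
    cong₂ ℕ._+_ (act-cong p f≐g m n n<N) (act-cong r f≐g m n n<N)
  act-cong (p ⊗ r) f≐g = act-cong p (act-cong r f≐g)

  act-zero : ∀ p → act p (λ _ _ → 0) ≐ λ _ _ → 0
  act-zero 𝟘       m       n       n<N = refl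
  act-zero 𝟙       m       n       n<N = refl
  act-zero X       zero    n       n<N = refl
  act-zero X       (suc m) n       n<N = refl
  act-zero Q       m       zero    n<N = refl
  act-zero Q       m       (suc n) n<N = refl
  act-zero (p ⊕ r) m       n       n<N = cong₂ ℕ._+_ (act-zero p m n n<N) (act-zero r m n n<N)
  act-zero (p ⊗ r) m       n       n<N =
    trans (act-cong p (act-zero r) m n n<N) (act-zero p m n n<N)

  interchange : ∀ a b c d → (a ℕ.+ b) ℕ.+ (c ℕ.+ d) ≡ (a ℕ.+ c) ℕ.+ (b ℕ.+ d)
  interchange = solve-∀

  act-+ : ∀ p f g → act p (λ m n → f m n ℕ.+ g m n) ≐ λ m n → act p f m n ℕ.+ act p g m n
  act-+ 𝟘       f g m       n       n<N = refl
  act-+ 𝟙       f g m       n       n<N = refl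
  act-+ X       f g zero    n       n<N = refl
  act-+ X       f g (suc m) n       n<N = refl
  act-+ Q       f g m       zero    n<N = refl
  act-+ Q       f g m       (suc n) n<N = refl
  act-+ (p ⊕ r) f g m       n       n<N =
    trans (cong₂ ℕ._+_ (act-+ p f g m n n<N) (act-+ r f g m n n<N))
          (interchange (act p f m n) (act p g m n) _ _)
  act-+ (p ⊗ r) f g m       n       n<N =
    trans (act-cong p (act-+ r f g) m n n<N) (act-+ p (act r f) (act r g) m n n<N)

  X-comm : ∀ r → X ⊗ r ≈ r ⊗ X
  X-comm 𝟘       f zero    n       n<N = refl
  X-comm 𝟘       f (suc m) n       n<N = refl
  X-comm 𝟙       f m       n       n<N = act-cong X (λ _ _ _ → refl) m n n<N
  X-comm X       f m       n       n<N = refl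
  X-comm Q       f zero    zero    n<N = refl
  X-comm Q       f zero    (suc n) n<N = refl
  X-comm Q       f (suc m) zero    n<N = refl
  X-comm Q       f (suc m) (suc n) n<N = refl
  X-comm (p ⊕ r) f zero    n       n<N = cong₂ ℕ._+_ (X-comm p f 0 n n<N) (X-comm r f 0 n n<N)
  X-comm (p ⊕ r) f (suc m) n       n<N =
    cong₂ ℕ._+_ (X-comm p f (suc m) n n<N) (X-comm r f (suc m) n n<N)
  X-comm (p ⊗ r) f m       n       n<N =
    trans (X-comm p (act r f) m n n<N) (act-cong p (X-comm r f) m n n<N)

  Q-comm : ∀ r → Q ⊗ r ≈ r ⊗ Q
  Q-comm 𝟘       f m       zero    n<N = refl
  Q-comm 𝟘       f m       (suc n) n<N = refl
  Q-comm 𝟙       f m       n       n<N = act-cong Q (λ _ _ _ → refl) m n n<N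
  Q-comm X       f m       n       n<N = sym (X-comm Q f m n n<N)
  Q-comm Q       f m       n       n<N = refl
  Q-comm (p ⊕ r) f m       zero    n<N = cong₂ ℕ._+_ (Q-comm p f m 0 n<N) (Q-comm r f m 0 n<N)
  Q-comm (p ⊕ r) f m       (suc n) n<N =
    cong₂ ℕ._+_ (Q-comm p f m (suc n) n<N) (Q-comm r f m (suc n) n<N)
  Q-comm (p ⊗ r) f m       n       n<N =
    trans (Q-comm p (act r f) m n n<N) (act-cong p (Q-comm r f) m n n<N)

  -- Induction on the left factor: the generators commute with every polynomial, and sums are
  -- handled by the additivity `act-+` of the other factor.
  ⊗-comm : ∀ p r → p ⊗ r ≈ r ⊗ p
  ⊗-comm 𝟘        r f m n n<N = sym (act-zero r m n n<N)
  ⊗-comm 𝟙        r f m n n<N = act-cong r (λ _ _ _ → refl) m n n<N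
  ⊗-comm X        r f m n n<N = X-comm r f m n n<N
  ⊗-comm Q        r f m n n<N = Q-comm r f m n n<N
  ⊗-comm (p ⊕ p′) r f m n n<N =
    trans (cong₂ ℕ._+_ (⊗-comm p r f m n n<N) (⊗-comm p′ r f m n n<N))
          (sym (act-+ r (act p f) (act p′ f) m n n<N))
  ⊗-comm (p ⊗ p′) r f m n n<N =
    trans (act-cong p (⊗-comm p′ r f) m n n<N) (⊗-comm p r (act p′ f) m n n<N)

  semiring : CommutativeSemiring 0ℓ 0ℓ
  semiring = record
    { Carrier = Poly ; _≈_ = _≈_ ; _+_ = _⊕_ ; _*_ = _⊗_ ; 0# = 𝟘 ; 1# = 𝟙
    ; isCommutativeSemiring = IsCommutativeSemiringˡ.isCommutativeSemiring record
      { +-isCommutativeMonoid = record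
        { isMonoid = record
          { isSemigroup = record
            { isMagma = record
              { isEquivalence = isEquiv
              ; ∙-cong = λ p≈ r≈ f m n n<N → cong₂ ℕ._+_ (p≈ f m n n<N) (r≈ f m n n<N)
              }
            ; assoc = λ p r s f m n _ → ℕ.+-assoc (act p f m n) _ _
            }
          ; identity = (λ p f m n _ → refl) , (λ p f m n _ → ℕ.+-identityʳ _)
          }
        ; comm = λ p r f m n _ → ℕ.+-comm (act p f m n) _
        }
      ; *-isCommutativeMonoid = record
        { isMonoid = record
          { isSemigroup = record
            { isMagma = record
              { isEquivalence = isEquiv
              ; ∙-cong = λ {p} {p′} {r} {r′} p≈ r≈ f m n n<N →
                  trans (act-cong p (r≈ f) m n n<N) (p≈ (act r′ f) m n n<N)
              }
            ; assoc = λ p r s f m n _ → refl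
            }
          ; identity = (λ p f m n _ → refl) , (λ p f m n n<N → act-cong p (λ _ _ _ → refl) m n n<N)
          }
        ; comm = ⊗-comm
        }
      ; distribʳ = λ p r s f m n _ → refl
      ; zeroˡ = λ p f m n _ → refl
      }
    }
    where
    isEquiv : IsEquivalence _≈_
    isEquiv = record
      { refl = λ f m n _ → refl
      ; sym = λ p≈r f m n n<N → sym (p≈r f m n n<N)
      ; trans = λ p≈r r≈s f m n n<N → trans (p≈r f m n n<N) (r≈s f m n n<N)
      }

  ⊕-cancelʳ : RightCancellative _≈_ _⊕_
  ⊕-cancelʳ s p r eq f m n n<N = ℕ.+-cancelʳ-≡ (act s f m n) _ _ (eq f m n n<N)

  open import Algebra.Definitions.RawSemiring (CommutativeSemiring.rawSemiring semiring) public
    using (_^_)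

  -- At k = N this is the nilpotency q^N = 0: multiplication by `Q ^ N` moves everything out of the
  -- window n < N.
  Q^-vanishes : ∀ k f m n → n ℕ.< k → act (Q ^ k) f m n ≡ 0
  Q^-vanishes (suc k) f m zero    n<k       = refl
  Q^-vanishes (suc k) f m (suc n) (ℕ.s≤s n<k) = Q^-vanishes k f m n n<k

  open FunctionalEquation semiring ⊕-cancelʳ Q public using (schurGF; oddGF; module Nilpotent)
  open Nilpotent N (Q^-vanishes N) public using (F≈oddGF)

-- Counting by two statistics.

Fibre : {A : Set} → (A → ℕ) → (A → ℕ) → ℕ → ℕ → Set
Fibre {A} μ ν m n = Σ A λ a → μ a ≡ m × ν a ≡ n

Fibre-≡ : ∀ {A : Set} {μ ν : A → ℕ} {m n} {x y : Fibre μ ν m n} → proj₁ x ≡ proj₁ y → x ≡ y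
Fibre-≡ {x = _ , p , q} {y = _ , p′ , q′} refl =
  cong₂ (λ p q → _ , p , q) (ℕ.≡-irrelevant p p′) (ℕ.≡-irrelevant q q′)

-- The array `f` is the generating function of A by (μ, ν). Bijections with `Fin` let an equality of
-- coefficients become a bijection of sets.
Counts : {A : Set} → (A → ℕ) → (A → ℕ) → Grid → Set
Counts μ ν f = ∀ m n → Fibre μ ν m n ↔ Fin (f m n)

empty↔ : ∀ {A : Set} → ¬ A → A ↔ Fin 0
empty↔ ¬a = mk↔ₛ′ (λ a → ⊥-elim (¬a a)) (λ ()) (λ ()) (λ a → ⊥-elim (¬a a))

module _ {A B : Set} {μ ν : A → ℕ} {μ′ ν′ : B → ℕ} where

  transport : (e : A ↔ B) → (∀ a → μ a ≡ μ′ (Inverse.to e a)) → (∀ a → ν a ≡ ν′ (Inverse.to e a)) →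
    ∀ {m n} → Fibre μ ν m n ↔ Fibre μ′ ν′ m n
  transport e μ≡ ν≡ = mk↔ₛ′
    (λ (a , p , q) → to a , trans (sym (μ≡ a)) p , trans (sym (ν≡ a)) q)
    (λ (b , p , q) → from b ,
      trans (trans (μ≡ _) (cong μ′ (strictlyInverseˡ b))) p ,
      trans (trans (ν≡ _) (cong ν′ (strictlyInverseˡ b))) q)
    (λ (b , _) → Fibre-≡ (strictlyInverseˡ b))
    (λ (a , _) → Fibre-≡ (strictlyInverseʳ a))
    where open Inverse e

  counts-⊎ : ∀ {f g} → Counts μ ν f → Counts μ′ ν′ g →
    Counts [ μ , μ′ ] [ ν , ν′ ] (λ m n → f m n ℕ.+ g m n)
  counts-⊎ cf cg m n = ↔-sym +↔⊎ ↔-∘ ((cf m n ⊎-↔ cg m n) ↔-∘ split)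
    where
    split : Fibre [ μ , μ′ ] [ ν , ν′ ] m n ↔ (Fibre μ ν m n ⊎ Fibre μ′ ν′ m n)
    split = mk↔ₛ′
      (λ { (inj₁ a , h) → inj₁ (a , h) ; (inj₂ b , h) → inj₂ (b , h) })
      [ (λ (a , h) → inj₁ a , h) , (λ (b , h) → inj₂ b , h) ]
      (λ { (inj₁ _) → refl ; (inj₂ _) → refl })
      (λ { (inj₁ _ , _) → refl ; (inj₂ _ , _) → refl })

module _ {A : Set} where

  counts-X : ∀ {μ ν : A → ℕ} {f} → Counts μ ν f → Counts (suc ∘ μ) ν (act X f)
  counts-X cf zero    n = empty↔ λ ()
  counts-X cf (suc m) n = cf m n ↔-∘ mk↔ₛ′
    (λ (a , p , q) → a , ℕ.suc-injective p , q) (λ (a , p , q) → a , cong suc p , q)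
    (λ _ → Fibre-≡ refl) (λ _ → Fibre-≡ refl)

  counts-Q : ∀ {μ ν : A → ℕ} {f} → Counts μ ν f → Counts μ (suc ∘ ν) (act Q f)
  counts-Q cf m zero    = empty↔ λ ()
  counts-Q cf m (suc n) = cf m n ↔-∘ mk↔ₛ′
    (λ (a , p , q) → a , p , ℕ.suc-injective q) (λ (a , p , q) → a , p , cong suc q)
    (λ _ → Fibre-≡ refl) (λ _ → Fibre-≡ refl)

module _ (N : ℕ) where

  open Truncated N

  counts-monomial : ∀ {A : Set} {μ ν : A → ℕ} {f} a b → Counts μ ν f →
    Counts (λ x → a ℕ.+ μ x) (λ x → b ℕ.+ ν x) (act (X ^ a ⊗ Q ^ b) f)
  counts-monomial (suc a) b       cf = counts-X (counts-monomial a b cf)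
  counts-monomial zero    (suc b) cf = counts-Q (counts-monomial zero b cf)
  counts-monomial zero    zero    cf = cf

-- Both families of partitions as inductive predicates.

open Equivalence using (to; from)

-- Sch n l π: π is a Schur partition with all parts at most n ∸ l.
data Sch : ℕ → ℕ → List ℕ → Set where
  base : ∀ {l} → Sch 0 l []
  back : ∀ {n l π} → Sch n l π → Sch (suc n) (suc l) π
  skip : ∀ {n π} → Sch n 0 π → Sch (suc n) 0 π
  take : ∀ {n π} → Sch n (lag (suc n)) π → Sch (suc n) 0 (suc n ∷ π)

-- In a non-increasing list a bound on the head bounds every part.
data HeadBound (b : ℕ) : List ℕ → Set where
  []  : HeadBound b []
  _∷_ : ∀ {a} → a ≤ b → ∀ π → HeadBound b (a ∷ π)

weaken : ∀ {b c π} → b ≤ c → HeadBound b π → HeadBound c π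
weaken b≤c []        = []
weaken b≤c (a≤b ∷ π) = ℕ.≤-trans a≤b b≤c ∷ π

Sch-bound : ∀ {n l π} → Sch n l π → HeadBound (n ℕ.∸ l) π
Sch-bound base     = []
Sch-bound (back h) = Sch-bound h
Sch-bound (skip h) = weaken (ℕ.n≤1+n _) (Sch-bound h)
Sch-bound (take h) = ℕ.≤-refl ∷ _

Sch-fresh : ∀ {n π} → ¬ Sch n 0 (suc n ∷ π)
Sch-fresh h with Sch-bound h
... | 1+n≤n ∷ _ = ℕ.1+n≰n 1+n≤n

-- `skip` and `take` exclude each other, since `skip` leaves no room for the part n + 1. Hence
-- counting derivations counts partitions.
Sch-irrelevant : ∀ {n l π} (h h′ : Sch n l π) → h ≡ h′
Sch-irrelevant base     base      = refl
Sch-irrelevant (back h) (back h′) = cong back (Sch-irrelevant h h′)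
Sch-irrelevant (skip h) (skip h′) = cong skip (Sch-irrelevant h h′)
Sch-irrelevant (skip h) (take h′) = ⊥-elim (Sch-fresh h)
Sch-irrelevant (take h) (skip h′) = ⊥-elim (Sch-fresh h′)
Sch-irrelevant (take h) (take h′) = cong take (Sch-irrelevant h h′)

-- OT k π: π is a partition into odd parts less than 2k, each part occurring at most twice.
data OT : ℕ → List ℕ → Set where
  none : OT 0 []
  zero : ∀ {k π} → OT k π → OT (suc k) π
  one  : ∀ {k π} → OT k π → OT (suc k) (suc (k ℕ.* 2) ∷ π)
  two  : ∀ {k π} → OT k π → OT (suc k) (suc (k ℕ.* 2) ∷ suc (k ℕ.* 2) ∷ π)

OT-bound : ∀ {k π} → OT k π → HeadBound (k ℕ.* 2) π
OT-bound none     = []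
OT-bound (zero h) = weaken (ℕ.m≤n+m _ 2) (OT-bound h)
OT-bound (one h)  = ℕ.n≤1+n _ ∷ _
OT-bound (two h)  = ℕ.n≤1+n _ ∷ _

OT-fresh : ∀ {k π} → ¬ OT k (suc (k ℕ.* 2) ∷ π)
OT-fresh h with OT-bound h
... | 1+n≤n ∷ _ = ℕ.1+n≰n 1+n≤n

-- The number of leading copies of 2k + 1 dictates the constructor.
OT-irrelevant : ∀ {k π} (h h′ : OT k π) → h ≡ h′
OT-irrelevant none     none      = refl
OT-irrelevant (zero h) (zero h′) = cong zero (OT-irrelevant h h′)
OT-irrelevant (zero h) (one h′)  = ⊥-elim (OT-fresh h)
OT-irrelevant (zero h) (two h′)  = ⊥-elim (OT-fresh h)
OT-irrelevant (one h)  (zero h′) = ⊥-elim (OT-fresh h′)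
OT-irrelevant (one h)  (one h′)  = cong one (OT-irrelevant h h′)
OT-irrelevant (one h)  (two h′)  = ⊥-elim (OT-fresh h)
OT-irrelevant (two h)  (zero h′) = ⊥-elim (OT-fresh h′)
OT-irrelevant (two h)  (one h′)  = ⊥-elim (OT-fresh h′)
OT-irrelevant (two h)  (two h′)  = cong two (OT-irrelevant h h′)

-- An even part counts twice in m, once in the length and once in `numEven`; this is why `wt` is the
-- exponent of x.
mStat-∷ : ∀ a π → mStat (a ∷ π) ≡ wt a ℕ.+ mStat π
mStat-∷ a π with isEven a
... | true  = cong suc (ℕ.+-suc (length π) (numEven π))
... | false = refl

-- Generating functions of the two families.

module _ (N : ℕ) where

  open Truncated N

  counts-[] : ∀ {B : List ℕ → Set} {μ : List ℕ → ℕ} → μ [] ≡ 0 → (b : B []) →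
    (∀ {π} (h : B π) → (π , h) ≡ ([] , b)) →
    Counts {Σ (List ℕ) B} (μ ∘ proj₁) (sum ∘ proj₁) δ
  counts-[] μ≡ b uniq zero zero = ↔-sym 1↔⊤ ↔-∘ mk↔ₛ′ (λ _ → tt) (λ _ → ([] , b) , μ≡ , refl)
    (λ _ → refl) (λ ((π , h) , _) → Fibre-≡ (sym (uniq h)))
  counts-[] μ≡ b uniq zero (suc n) = empty↔ λ ((π , h) , _ , q) →
    ℕ.0≢1+n (trans (cong (sum ∘ proj₁) (sym (uniq h))) q)
  counts-[] {μ = μ} μ≡ b uniq (suc m) n = empty↔ λ ((π , h) , p , _) →
    ℕ.0≢1+n (trans (sym μ≡) (trans (cong (μ ∘ proj₁) (sym (uniq h))) p))

  -- The constructors of `Sch` follow the clauses of `schurGF`: `back` is the clause lowering both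
  -- indices, while `skip` and `take` are the two summands of the last clause.
  counts-Sch : ∀ n l →
    Counts {Σ (List ℕ) (Sch n l)} (mStat ∘ proj₁) (sum ∘ proj₁) (act (schurGF X n l) δ)
  counts-Sch zero    l       = counts-[] refl base λ { base → refl }
  counts-Sch (suc n) (suc l) i j = counts-Sch n l i j ↔-∘ transport
    (mk↔ₛ′ (λ { (π , back h) → π , h }) (λ (π , h) → π , back h)
      (λ _ → refl) (λ { (_ , back _) → refl }))
    (λ { (_ , back _) → refl }) (λ { (_ , back _) → refl })
  counts-Sch (suc n) zero    i j =
    counts-⊎ (counts-Sch n 0) (counts-monomial N (wt (suc n)) (suc n) (counts-Sch n (lag (suc n)))) i j
    ↔-∘ transport
      (mk↔ₛ′ (λ { (π , skip h) → inj₁ (π , h) ; (_ ∷ π , take h) → inj₂ (π , h) })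
        [ (λ (π , h) → π , skip h) , (λ (π , h) → suc n ∷ π , take h) ]
        (λ { (inj₁ _) → refl ; (inj₂ _) → refl })
        (λ { (_ , skip _) → refl ; (_ , take _) → refl }))
      (λ { (_ , skip _) → refl ; (_ ∷ π , take _) → mStat-∷ (suc n) π })
      (λ { (_ , skip _) → refl ; (_ , take _) → refl })

  counts-OT : ∀ k → Counts {Σ (List ℕ) (OT k)} (length ∘ proj₁) (sum ∘ proj₁) (act (oddGF X k) δ)
  counts-OT zero    = counts-[] refl none λ { none → refl }
  counts-OT (suc k) i j =
    counts-⊎ (counts-⊎ (counts-OT k) (counts-monomial N 1 o (counts-OT k)))
             (counts-monomial N 2 (o ℕ.+ o) (counts-OT k)) i j
    ↔-∘ transport
      (mk↔ₛ′ (λ { (π , zero h)        → inj₁ (inj₁ (π , h))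
                ; (_ ∷ π , one h)     → inj₁ (inj₂ (π , h))
                ; (_ ∷ _ ∷ π , two h) → inj₂ (π , h) })
        [ [ (λ (π , h) → π , zero h) , (λ (π , h) → o ∷ π , one h) ]
        , (λ (π , h) → o ∷ o ∷ π , two h) ]
        (λ { (inj₁ (inj₁ _)) → refl ; (inj₁ (inj₂ _)) → refl ; (inj₂ _) → refl })
        (λ { (_ , zero _) → refl ; (_ , one _) → refl ; (_ , two _) → refl }))
      (λ { (_ , zero _) → refl ; (_ , one _) → refl ; (_ , two _) → refl })
      (λ { (_ , zero _) → refl ; (_ , one _) → refl
         ; (_ ∷ _ ∷ π , two _) → sym (ℕ.+-assoc o o (sum π)) })
    where
    o : ℕ
    o = suc (k ℕ.* 2)

-- The Boolean Schur condition against the recursive one.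

¬T⇒T-not-∧ : ∀ x y → ¬ T x → T (not (x ∧ y))
¬T⇒T-not-∧ true  y ¬x = ⊥-elim (¬x tt)
¬T⇒T-not-∧ false y ¬x = tt

T-not-∧-false : ∀ x → T (not (x ∧ false))
T-not-∧-false true  = tt
T-not-∧-false false = tt

-- The Booleans d and e stand for divisibility of n + 1 and b by 3, which agree when the difference
-- is exactly 3. So if d is true, that difference is excluded and the gap is at least 4; otherwise
-- it is at least 3.
pair⇒lag : ∀ d e n b → (suc n ≡ b ℕ.+ 3 → e ≡ d) →
  T ((b ℕ.+ 3 ℕ.≤ᵇ suc n) ∧ not ((suc n ℕ.≡ᵇ b ℕ.+ 3) ∧ (d ∧ e))) →
  b ≤ n ℕ.∸ (if d then 3 else 2)
pair⇒lag false e n b e≡d h = ℕ.m+n≤o⇒m≤o∸n b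
  (ℕ.≤-pred (subst (_≤ suc n) (ℕ.+-suc b 2) (ℕ.≤ᵇ⇒≤ _ _ (proj₁ (to T-∧ h)))))
pair⇒lag true e n b e≡d h = ℕ.m+n≤o⇒m≤o∸n b
  (ℕ.≤-pred (ℕ.≤∧≢⇒< (ℕ.≤ᵇ⇒≤ _ _ (proj₁ (to T-∧ h))) b+3≢1+n))
  where
  b+3≢1+n : b ℕ.+ 3 ≢ suc n
  b+3≢1+n eq with e≡d (sym eq)
  ... | refl with suc n ℕ.≡ᵇ b ℕ.+ 3 | ℕ.≡⇒≡ᵇ (suc n) (b ℕ.+ 3) (sym eq)
                | proj₂ (to (T-∧ {b ℕ.+ 3 ℕ.≤ᵇ suc n}) h)
  ...   | true | _ | ()

-- Positivity of b rules out that the subtraction was truncated to 0.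
≤∸⇒+≤ : ∀ k n b → 1 ≤ b → b ≤ n ℕ.∸ k → b ℕ.+ k ≤ n
≤∸⇒+≤ k n b 1≤b b≤ = ℕ.m≤o∸n⇒m+n≤o b
  (ℕ.<⇒≤ (ℕ.m∸n≢0⇒n<m (ℕ.>⇒≢ (ℕ.≤-trans 1≤b b≤)))) b≤

lag⇒pair : ∀ d e n b → 1 ≤ b → b ≤ n ℕ.∸ (if d then 3 else 2) →
  T ((b ℕ.+ 3 ℕ.≤ᵇ suc n) ∧ not ((suc n ℕ.≡ᵇ b ℕ.+ 3) ∧ (d ∧ e)))
lag⇒pair false e n b 1≤b b≤ = from T-∧
  ( ℕ.≤⇒≤ᵇ (subst (_≤ suc n) (sym (ℕ.+-suc b 2)) (s≤s (≤∸⇒+≤ 2 n b 1≤b b≤)))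
  , T-not-∧-false (suc n ℕ.≡ᵇ b ℕ.+ 3))
lag⇒pair true e n b 1≤b b≤ = from T-∧
  ( ℕ.≤⇒≤ᵇ (ℕ.m≤n⇒m≤1+n b+3≤n)
  , ¬T⇒T-not-∧ _ e λ eq → ℕ.1+n≰n (subst (_≤ n) (sym (ℕ.≡ᵇ⇒≡ (suc n) _ eq)) b+3≤n))
  where
  b+3≤n : b ℕ.+ 3 ≤ n
  b+3≤n = ≤∸⇒+≤ 3 n b 1≤b b≤

divBy3-shift : ∀ {n} b → suc n ≡ b ℕ.+ 3 → divBy3 b ≡ divBy3 (suc n)
divBy3-shift b eq = trans (cong (ℕ._≡ᵇ 0) (sym ([m+n]%n≡m%n b 3))) (cong divBy3 (sym eq))

schurPair⇒≤ : ∀ n b → T (schurPair (suc n) b) → b ≤ n ℕ.∸ lag (suc n)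
schurPair⇒≤ n b = pair⇒lag (divBy3 (suc n)) (divBy3 b) n b (divBy3-shift b)

≤⇒schurPair : ∀ n b → 1 ≤ b → b ≤ n ℕ.∸ lag (suc n) → T (schurPair (suc n) b)
≤⇒schurPair n b = lag⇒pair (divBy3 (suc n)) (divBy3 b) n b

Sch⇒positive : ∀ {n l π} → Sch n l π → T (allPositive π)
Sch⇒positive base     = tt
Sch⇒positive (back h) = Sch⇒positive h
Sch⇒positive (skip h) = Sch⇒positive h
Sch⇒positive (take h) = Sch⇒positive h

schurGaps-∷ : ∀ n π → T (allPositive π) → HeadBound (n ℕ.∸ lag (suc n)) π →
  T (schurGaps π) → T (schurGaps (suc n ∷ π))
schurGaps-∷ n []      pos bound    gaps = tt
schurGaps-∷ n (b ∷ π) pos (b≤ ∷ _) gaps = from T-∧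
  (≤⇒schurPair n b (ℕ.≤ᵇ⇒≤ 1 b (proj₁ (to T-∧ pos))) b≤ , gaps)

schurGaps-tail : ∀ n π → T (schurGaps (suc n ∷ π)) →
  HeadBound (n ℕ.∸ lag (suc n)) π × T (schurGaps π)
schurGaps-tail n []      _    = [] , tt
schurGaps-tail n (b ∷ π) gaps =
  let pair , gaps′ = to T-∧ gaps in schurPair⇒≤ n b pair ∷ π , gaps′

Sch⇒gaps : ∀ {n l π} → Sch n l π → T (schurGaps π)
Sch⇒gaps base     = tt
Sch⇒gaps (back h) = Sch⇒gaps h
Sch⇒gaps (skip h) = Sch⇒gaps h
Sch⇒gaps (take h) = schurGaps-∷ _ _ (Sch⇒positive h) (Sch-bound h) (Sch⇒gaps h)

-- The bound descends to 0. A head equal to the bound is taken, and the gap condition then bounds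
-- the tail; any other head is skipped. At bound 0 a nonempty list contradicts positivity or the
-- bound.
schur⇒Sch : ∀ n l π → T (allPositive π) → T (schurGaps π) → HeadBound (n ℕ.∸ l) π → Sch n l π
schur⇒Sch zero    l       []      pos gaps bound     = base
schur⇒Sch zero    zero    (zero ∷ π) () gaps bound
schur⇒Sch zero    zero    (suc a ∷ π) pos gaps (() ∷ _)
schur⇒Sch zero    (suc l) (zero ∷ π) () gaps bound
schur⇒Sch zero    (suc l) (suc a ∷ π) pos gaps (() ∷ _)
schur⇒Sch (suc n) (suc l) π       pos gaps bound     = back (schur⇒Sch n l π pos gaps bound)
schur⇒Sch (suc n) zero    []      pos gaps bound     = skip (schur⇒Sch n 0 [] tt tt [])
schur⇒Sch (suc n) zero    (a ∷ π) pos gaps (a≤ ∷ _) with a ℕ.≟ suc n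
... | yes refl = let bound , gaps′ = schurGaps-tail n π gaps in
                 take (schur⇒Sch n _ π (proj₂ (to T-∧ pos)) gaps′ bound)
... | no a≢    = skip (schur⇒Sch n 0 (a ∷ π) pos gaps (ℕ.≤-pred (ℕ.≤∧≢⇒< a≤ a≢) ∷ π))

-- Odd parts with multiplicity at most two.

count-∷-≡ : ∀ a π → count a (a ∷ π) ≡ suc (count a π)
count-∷-≡ a π with a ℕ.≡ᵇ a | ℕ.≡⇒≡ᵇ a a refl
... | true | _ = refl

count-∷-≤ : ∀ x a π → count x π ≤ count x (a ∷ π)
count-∷-≤ x a π with a ℕ.≡ᵇ x
... | true  = ℕ.n≤1+n _
... | false = ℕ.≤-refl

count-∷-≢ : ∀ x a π → a ≢ x → count x (a ∷ π) ≡ count x π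
count-∷-≢ x a π a≢x with a ℕ.≡ᵇ x | ℕ.≡ᵇ⇒≡ a x
... | true  | eq = contradiction (eq tt) a≢x
... | false | _  = refl

isEven-double : ∀ k → isEven (k ℕ.* 2) ≡ true
isEven-double k = cong (ℕ._≡ᵇ 0) ([m+kn]%n≡m%n 0 k 2)

isOdd-double+1 : ∀ k → isOdd (suc (k ℕ.* 2)) ≡ true
isOdd-double+1 k = cong (λ r → not (r ℕ.≡ᵇ 0)) ([m+kn]%n≡m%n 1 k 2)

OT⇒odd : ∀ {k π} → OT k π → T (all isOdd π)
OT⇒odd none         = tt
OT⇒odd (zero h)     = OT⇒odd h
OT⇒odd (one {k} h) rewrite isOdd-double+1 k = OT⇒odd h
OT⇒odd (two {k} h) rewrite isOdd-double+1 k = OT⇒odd h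

nonIncreasing-∷ : ∀ {a π} → HeadBound a π → T (nonIncreasing π) → T (nonIncreasing (a ∷ π))
nonIncreasing-∷ []        mono = tt
nonIncreasing-∷ (b≤a ∷ π) mono = from T-∧ (ℕ.≤⇒≤ᵇ b≤a , mono)

nonIncreasing-tail : ∀ {a} π → T (nonIncreasing (a ∷ π)) → HeadBound a π × T (nonIncreasing π)
nonIncreasing-tail []      _    = [] , tt
nonIncreasing-tail (b ∷ π) mono =
  let b≤a , mono′ = to T-∧ mono in ℕ.≤ᵇ⇒≤ _ _ b≤a ∷ π , mono′

OT⇒nonIncreasing : ∀ {k π} → OT k π → T (nonIncreasing π)
OT⇒nonIncreasing none     = tt
OT⇒nonIncreasing (zero h) = OT⇒nonIncreasing h
OT⇒nonIncreasing (one h)  = nonIncreasing-∷ (weaken (ℕ.n≤1+n _) (OT-bound h)) (OT⇒nonIncreasing h)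
OT⇒nonIncreasing (two {k} {π} h) = nonIncreasing-∷ {o} {o ∷ π} (ℕ.≤-refl ∷ π)
  (nonIncreasing-∷ {o} (weaken (ℕ.n≤1+n _) (OT-bound h)) (OT⇒nonIncreasing h))
  where
  o : ℕ
  o = suc (k ℕ.* 2)

OT⇒count≡0 : ∀ {k π} x → OT k π → k ℕ.* 2 < x → count x π ≡ 0
OT⇒count≡0 x none     2k<x = refl
OT⇒count≡0 x (zero h) 2k<x = OT⇒count≡0 x h (ℕ.<-trans (ℕ.m<n+m _ (s≤s z≤n)) 2k<x)
OT⇒count≡0 x (one {k} {π} h) 2k<x =
  trans (count-∷-≢ x o π (ℕ.<⇒≢ o<x)) (OT⇒count≡0 x h (ℕ.<-trans (ℕ.n<1+n _) o<x))
  where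
  o : ℕ
  o = suc (k ℕ.* 2)
  o<x : o < x
  o<x = ℕ.<-trans (ℕ.n<1+n o) 2k<x
OT⇒count≡0 x (two {k} {π} h) 2k<x =
  trans (count-∷-≢ x o (o ∷ π) (ℕ.<⇒≢ o<x))
    (trans (count-∷-≢ x o π (ℕ.<⇒≢ o<x)) (OT⇒count≡0 x h (ℕ.<-trans (ℕ.n<1+n _) o<x)))
  where
  o : ℕ
  o = suc (k ℕ.* 2)
  o<x : o < x
  o<x = ℕ.<-trans (ℕ.n<1+n o) 2k<x

-- Copies of 2k + 1 come from the outermost constructor only, because the remaining parts are at
-- most 2k.
OT⇒count≤2 : ∀ {k π} x → OT k π → count x π ≤ 2
OT⇒count≤2 x none     = z≤n
OT⇒count≤2 x (zero h) = OT⇒count≤2 x h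
OT⇒count≤2 x (one {k} {π} h) with suc (k ℕ.* 2) ℕ.≟ x
... | yes refl rewrite count-∷-≡ x π | OT⇒count≡0 x h ℕ.≤-refl = s≤s z≤n
... | no o≢x   rewrite count-∷-≢ x _ π o≢x = OT⇒count≤2 x h
OT⇒count≤2 x (two {k} {π} h) with suc (k ℕ.* 2) ℕ.≟ x
... | yes refl rewrite count-∷-≡ x (x ∷ π) | count-∷-≡ x π | OT⇒count≡0 x h ℕ.≤-refl = ℕ.≤-refl
... | no o≢x   rewrite count-∷-≢ x _ (suc (k ℕ.* 2) ∷ π) o≢x | count-∷-≢ x _ π o≢x =
  OT⇒count≤2 x h

all⁺ : ∀ (p : ℕ → Bool) π → All (T ∘ p) π → T (all p π)
all⁺ p []      []       = tt
all⁺ p (a ∷ π) (h ∷ hs) = from T-∧ (h , all⁺ p π hs)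

all⁻ : ∀ (p : ℕ → Bool) π → T (all p π) → All (T ∘ p) π
all⁻ p []      _ = []
all⁻ p (a ∷ π) h = let h , hs = to T-∧ h in h ∷ all⁻ p π hs

AtMostTwice : List ℕ → Set
AtMostTwice π = All (λ x → count x π ≤ 2) π

AtMostTwice-tail : ∀ {a π} → AtMostTwice (a ∷ π) → AtMostTwice π
AtMostTwice-tail {a} {π} (_ ∷ hs) = All.map (λ {x} → ℕ.≤-trans (count-∷-≤ x a π)) hs

¬AtMostTwice-thrice : ∀ a π → ¬ AtMostTwice (a ∷ a ∷ a ∷ π)
¬AtMostTwice-thrice a π (h ∷ _)
  rewrite count-∷-≡ a (a ∷ a ∷ π) | count-∷-≡ a (a ∷ π) | count-∷-≡ a π with h
... | s≤s (s≤s ())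

tighten : ∀ {b π} → HeadBound (suc b) π → (∀ π′ → π ≢ suc b ∷ π′) → HeadBound b π
tighten []       _ = []
tighten (a≤ ∷ π) ≢ = ℕ.≤-pred (ℕ.≤∧≢⇒< a≤ λ eq → ≢ π (cong (_∷ π) eq)) ∷ π

-- Since 2k + 2 is even, the head is at most 2k + 1. Whether 2k + 1 leads zero, one or two times
-- selects the constructor, and a third copy would contradict `AtMostTwice`.
oddPartition⇒OT : ∀ k π → T (nonIncreasing π) → All (T ∘ isOdd) π → AtMostTwice π →
  HeadBound (k ℕ.* 2) π → OT k π
oddPartition⇒OT zero    []      mono odd twice bound = none
oddPartition⇒OT zero    (.0 ∷ π) mono (() ∷ _) twice (z≤n ∷ _)
oddPartition⇒OT (suc k) []      mono odd twice bound = zero (oddPartition⇒OT k [] tt [] [] [])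
oddPartition⇒OT (suc k) (a ∷ π) mono (odd ∷ odds) twice (a≤ ∷ _) with a ℕ.≟ suc (k ℕ.* 2)
oddPartition⇒OT (suc k) (a ∷ π) mono (odd ∷ odds) twice (a≤ ∷ _) | no a≢ =
  zero (oddPartition⇒OT k (a ∷ π) mono (odd ∷ odds) twice (ℕ.≤-pred (ℕ.≤∧≢⇒< a≤o a≢) ∷ π))
  where
  a≤o : a ≤ suc (k ℕ.* 2)
  a≤o = ℕ.≤-pred (ℕ.≤∧≢⇒< a≤ λ { refl → subst (T ∘ not) (isEven-double (suc k)) odd })
oddPartition⇒OT (suc k) (a ∷ []) mono odd twice bound | yes refl =
  one (oddPartition⇒OT k [] tt [] [] [])
oddPartition⇒OT (suc k) (a ∷ b ∷ π) mono (_ ∷ odd ∷ odds) twice bound | yes refl with b ℕ.≟ a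
... | no b≢a =
  let bound′ , mono′ = nonIncreasing-tail (b ∷ π) mono in
  one (oddPartition⇒OT k (b ∷ π) mono′ (odd ∷ odds) (AtMostTwice-tail twice)
        (tighten bound′ λ { _ refl → b≢a refl }))
... | yes refl =
  let bound′ , mono′ = nonIncreasing-tail {b} π (proj₂ (nonIncreasing-tail {b} (b ∷ π) mono)) in
  two (oddPartition⇒OT k π mono′ odds (AtMostTwice-tail (AtMostTwice-tail twice))
        (tighten bound′ λ { π′ refl → ¬AtMostTwice-thrice _ π′ twice }))

-- Assembling the bijection.

HeadBound-sum : ∀ {n} π → sum π ≤ n → HeadBound n π
HeadBound-sum []      _   = []
HeadBound-sum (a ∷ π) sum≤ = ℕ.≤-trans (ℕ.m≤m+n a (sum π)) sum≤ ∷ π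

Σ-T-≡ : ∀ {A : Set} {p : A → Bool} {x y : Σ A (T ∘ p)} → proj₁ x ≡ proj₁ y → x ≡ y
Σ-T-≡ refl = cong (_ ,_) (T-irrelevant _ _)

Fibre-Σ-≡ : ∀ {B : List ℕ → Set} {μ ν : List ℕ → ℕ} {m n} → (∀ {π} (h h′ : B π) → h ≡ h′) →
  {x y : Fibre {Σ (List ℕ) B} (μ ∘ proj₁) (ν ∘ proj₁) m n} →
  proj₁ (proj₁ x) ≡ proj₁ (proj₁ y) → x ≡ y
Fibre-Σ-≡ irr {(_ , h) , _} {(_ , h′) , _} refl = Fibre-≡ (cong (_ ,_) (irr h h′))

-- No part of a partition of n exceeds n, so the bound in `Sch b l` excludes nothing. The list
-- itself is unchanged, and the inverse laws reduce to irrelevance of the membership proofs.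
D↔Fibre : ∀ m {n} b l → n ≤ b ℕ.∸ l →
  D m n ↔ Fibre {Σ (List ℕ) (Sch b l)} (mStat ∘ proj₁) (sum ∘ proj₁) m n
D↔Fibre m {n} b l n≤ = mk↔ₛ′ f g (λ _ → Fibre-Σ-≡ Sch-irrelevant refl) (λ _ → Σ-T-≡ refl)
  where
  f : D m n → Fibre {Σ (List ℕ) (Sch b l)} (mStat ∘ proj₁) (sum ∘ proj₁) m n
  f (π , h) =
    let schur , h₁ = to T-∧ h
        pos , gaps = to T-∧ schur
        sum≡ , mStat≡ = to T-∧ h₁
        sum≡n = ℕ.≡ᵇ⇒≡ _ _ sum≡
    in (π , schur⇒Sch b l π pos gaps (HeadBound-sum π (ℕ.≤-trans (ℕ.≤-reflexive sum≡n) n≤)))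
       , ℕ.≡ᵇ⇒≡ _ _ mStat≡ , sum≡n
  g : Fibre {Σ (List ℕ) (Sch b l)} (mStat ∘ proj₁) (sum ∘ proj₁) m n → D m n
  g ((π , h) , mStat≡ , sum≡) = π , from T-∧
    (from T-∧ (Sch⇒positive h , Sch⇒gaps h) , from T-∧ (ℕ.≡⇒≡ᵇ _ _ sum≡ , ℕ.≡⇒≡ᵇ _ _ mStat≡))

C↔Fibre : ∀ m {n} k → n ≤ k ℕ.* 2 →
  C m n ↔ Fibre {Σ (List ℕ) (OT k)} (length ∘ proj₁) (sum ∘ proj₁) m n
C↔Fibre m {n} k n≤ = mk↔ₛ′ f g (λ _ → Fibre-Σ-≡ OT-irrelevant refl) (λ _ → Σ-T-≡ refl)
  where
  f : C m n → Fibre {Σ (List ℕ) (OT k)} (length ∘ proj₁) (sum ∘ proj₁) m n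
  f (π , h) =
    let mono , h₁ = to T-∧ h
        odd , h₂ = to T-∧ h₁
        length≡ , h₃ = to T-∧ h₂
        sum≡ , twice = to T-∧ h₃
        sum≡n = ℕ.≡ᵇ⇒≡ _ _ sum≡
    in (π , oddPartition⇒OT k π mono (all⁻ isOdd π odd) (All.map (ℕ.≤ᵇ⇒≤ _ 2) (all⁻ _ π twice))
              (HeadBound-sum π (ℕ.≤-trans (ℕ.≤-reflexive sum≡n) n≤)))
       , ℕ.≡ᵇ⇒≡ _ _ length≡ , sum≡n
  g : Fibre {Σ (List ℕ) (OT k)} (length ∘ proj₁) (sum ∘ proj₁) m n → C m n
  g ((π , h) , length≡ , sum≡) = π , from T-∧ (OT⇒nonIncreasing h , from T-∧ (OT⇒odd h , from T-∧
    (ℕ.≡⇒≡ᵇ _ _ length≡ , from T-∧ (ℕ.≡⇒≡ᵇ _ _ sum≡ ,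
      all⁺ _ π (All.universal (λ x → ℕ.≤⇒≤ᵇ (OT⇒count≤2 x h)) π)))))

theorem5 : (m n : ℕ) → D m n ⤖ C m n
theorem5 m n = ↔⇒⤖
  (↔-sym (C↔Fibre m (suc n) (ℕ.≤-trans (ℕ.n≤1+n n) (ℕ.m≤m*n (suc n) 2))) ↔-∘
  (↔-sym (counts-OT (suc n) (suc n) m n) ↔-∘
  -- Truncation at N = n + 1 still sees the coefficient of q^n, so both sets are in bijection with
  -- the same `Fin`.
  (subst (λ c → D m n ↔ Fin c) (F≈oddGF X δ m n (ℕ.n<1+n n))
    (counts-Sch (suc n) b 1 m n ↔-∘ D↔Fibre m b 1 n≤b))))
  where
  open Truncated (suc n)
  b : ℕ
  -- This is 3(2N + 1) for N = n + 1, so `schurGF X b 1` is `F X` by computation.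
  b = 3 ℕ.+ suc n ℕ.* 2 ℕ.* 3
  n≤b : n ≤ b ℕ.∸ 1
  n≤b = ℕ.≤-trans (ℕ.≤-trans (ℕ.≤-trans (ℕ.n≤1+n n) (ℕ.m≤m*n (suc n) 2))
                              (ℕ.m≤m*n (suc n ℕ.* 2) 3)) (ℕ.m≤n+m _ 2)
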